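{- Let $k\le n$ be positive integers and let $\mathcal F$ be an $(n,k)$-strongly-selective family. (i) If $3\le k\le\sqrt{2n}-1$, then $|\mathcal F|\ge \dfrac{k^2}{48\log_2 k}\log_2 n$. (ii) If $k\ge\sqrt{2n}$, then $|\mathcal F|\ge n$.
   Context: Write $[n]=\{1,\dots,n\}$. For $k\le n$, a family $\mathcal F$ of subsets of $[n]$ is $(n,k)$-strongly-selective if for every $Z\subseteq[n]$ with $|Z|\le k$ and every $z\in Z$ there is $F\in\mathcal F$ with $Z\cap F=\{z\}$. -}

module Defs where

open import Data.Fin using (Fin)
open import Data.Fin.Subset using (Subset; _∈_; _∩_; ⁅_⁆; ∣_∣)
open import Data.List using (List; length)
open import Data.List.Membership.Propositional using () renaming (_∈_ to _∈ˡ_)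
open import Data.List.Relation.Unary.Unique.Propositional using (Unique)
open import Data.Nat using (ℕ; _≤_; _^_)
open import Data.Product using (∃; _×_)
open import Relation.Binary.PropositionalEquality using (_≡_)

-- A set of subsets of [n] = Fin n, given by a duplicate-free enumeration,
-- so that the length of the enumeration is the cardinality of the set.
record Family (n : ℕ) : Set where
  field
    members  : List (Subset n)
    distinct : Unique members

open Family public

size : ∀ {n} → Family n → ℕ
size 𝓕 = length (members 𝓕)

StronglySelective : (n k : ℕ) → Family n → Set
StronglySelective n k 𝓕 =
  (Z : Subset n) → ∣ Z ∣ ≤ k → (z : Fin n) → z ∈ Z →
  ∃ λ (F : Subset n) → F ∈ˡ members 𝓕 × Z ∩ F ≡ ⁅ z ⁆

-- The library has no real numbers, so comparisons of naturals with real
-- square roots and logarithms are encoded by the exactly equivalent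
-- comparisons of naturals.

infix 4 _≤√_ _≥√_ _·log₂_≤_·log₂_

_≤√_ : ℕ → ℕ → Set
x ≤√ y = x ^ 2 ≤ y

_≥√_ : ℕ → ℕ → Set
x ≥√ y = y ≤ x ^ 2

-- Meaningful only for x and y positive: there a · log₂ x ≤ b · log₂ y
-- between reals says log₂ (x ^ a) ≤ log₂ (y ^ b), and log₂ is strictly
-- increasing on the positive reals.
_·log₂_≤_·log₂_ : (a x b y : ℕ) → Set
a ·log₂ x ≤ b ·log₂ y = x ^ a ≤ y ^ b

{-# OPTIONS --safe #-}
module Submission where

open import Data.Bool using () renaming (_≟_ to _≟ᵇ_)
open import Data.Fin using (Fin)
open import Data.Fin.Properties using (any?; all?) renaming (_≟_ to _≟ᶠ_)
open import Data.Fin.Subset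
  using (Subset; Side; inside; outside; _∈_; _∉_; _⊆_; _∪_; _─_; ⋃; ⁅_⁆; ∣_∣; Nonempty)
  renaming (⊥ to ∅)
open import Data.Fin.Subset.Properties
open import Data.List
  using (List; []; _∷_; length; lookup; map; _++_; allFin; filter; partition; take)
open import Data.List.Membership.Propositional using (find)
open import Data.List.Properties using (length-++; length-take; length-tabulate; partition-defn)
import Data.List.Relation.Binary.Permutation.Setoid.Properties as PermutationProperties
open import Data.List.Relation.Unary.All as All using (All; []; _∷_)
open import Data.List.Relation.Unary.All.Properties using (all-filter) renaming (take⁺ to All-take⁺)
open import Data.List.Relation.Unary.AllPairs using ([]; _∷_)
open import Data.List.Relation.Unary.Any as Any using (Any; here; there)
open import Data.List.Relation.Unary.Any.Properties using (lookup-index; map⁺; map⁻)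
open import Data.List.Relation.Unary.Unique.Propositional using (Unique)
open import Data.List.Relation.Unary.Unique.Propositional.Properties
  using (allFin⁺; filter⁺; ++⁺; take⁺)
open import Data.Nat
  using (ℕ; zero; suc; _≤_; _<_; _≤?_; _+_; _*_; _∸_; _^_; _/_; z≤n; s≤s; s≤s⁻¹;
         NonZero; >-nonZero; >-nonZero⁻¹)
open import Data.Nat.DivMod using (_%_; m%n<n; m≡m%n+[m/n]*n; m/n*n≤m)
open import Data.Nat.Properties hiding (_≟_)
open import Data.Nat.Tactic.RingSolver using (solve-∀)
open import Data.Product using (∃; _×_; _,_; proj₁; proj₂)
open import Data.Sum using (_⊎_; inj₁; inj₂; [_,_]′)
open import Data.Vec as Vec using ([]; _∷_; tabulate)
open import Data.Vec.Properties using ([]=⇒lookup; lookup⇒[]=; lookup∘tabulate)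
open import Function using (_∘_)
open import Relation.Binary.PropositionalEquality
open import Relation.Nullary using (¬_; Dec; yes; no; contradiction; ¬?)
open import Relation.Nullary.Decidable using (_×-dec_; _→-dec_; decidable-stable)
open import Relation.Unary using (Decidable)
open import Defs

-- Dualize: with t = ∣ 𝓕 ∣, let A z ⊆ [t] be the set of members of 𝓕 containing z.  Selectivity
-- says that no A z is covered by k - 1 others.  Following Füredi, call S an own subset of A z if
-- S lies in no other A y.  If A z has no own subset of size at most m, then after removing i < k
-- other sets A y more than m (k - 1 - i) points of A z remain, since each further A y can be
-- chosen to absorb m of the remaining points.  Hence k such z force
--   2 t + m k ≥ 2 k + m k².
-- The other z inject into the subsets of size at most m, of which there are at most
-- ((L + 1) L)^m as soon as t ≤ L m.
--
-- For m = 1, when fewer than k sets lack an own subset, the sets A z, ordered so that these come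
-- first, each contribute a new point to the union, and n ≤ t.  So n ≤ t or k + k² ≤ 2 t, which
-- gives (ii), and k² ≤ 2 t in case (i).  For (i) then take m = 1 + ⌊3 t / k²⌋ and L = k²: now
-- 2 t + m k < 2 k + m k², so n ≤ ((k² + 1) k²)^m + k ≤ k^(6 m), and m k² ≤ 3 t + k² ≤ 5 t.

private
  variable
    n t : ℕ

-- Differences, unions and sizes of finite subsets.

x∈p─q⇒x∉q : ∀ (p q : Subset n) {x} → x ∈ p ─ q → x ∉ q
x∈p─q⇒x∉q (_ ∷ p) (inside  ∷ q) (Vec.there x∈p─q) (Vec.there x∈q) = x∈p─q⇒x∉q p q x∈p─q x∈q
x∈p─q⇒x∉q (_ ∷ p) (outside ∷ q) (Vec.there x∈p─q) (Vec.there x∈q) = x∈p─q⇒x∉q p q x∈p─q x∈q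

∣p─q∣+∣q∣≡∣p∪q∣ : ∀ (p q : Subset n) → ∣ p ─ q ∣ + ∣ q ∣ ≡ ∣ p ∪ q ∣
∣p─q∣+∣q∣≡∣p∪q∣ []            []            = refl
∣p─q∣+∣q∣≡∣p∪q∣ (outside ∷ p) (outside ∷ q) = ∣p─q∣+∣q∣≡∣p∪q∣ p q
∣p─q∣+∣q∣≡∣p∪q∣ (inside  ∷ p) (outside ∷ q) = cong suc (∣p─q∣+∣q∣≡∣p∪q∣ p q)
∣p─q∣+∣q∣≡∣p∪q∣ (outside ∷ p) (inside  ∷ q) =
  trans (+-suc ∣ p ─ q ∣ ∣ q ∣) (cong suc (∣p─q∣+∣q∣≡∣p∪q∣ p q))
∣p─q∣+∣q∣≡∣p∪q∣ (inside  ∷ p) (inside  ∷ q) =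
  trans (+-suc ∣ p ─ q ∣ ∣ q ∣) (cong suc (∣p─q∣+∣q∣≡∣p∪q∣ p q))

∣p∪q∣≤∣p∣+∣q∣ : ∀ (p q : Subset n) → ∣ p ∪ q ∣ ≤ ∣ p ∣ + ∣ q ∣
∣p∪q∣≤∣p∣+∣q∣ p q =
  ≤-trans (≤-reflexive (sym (∣p─q∣+∣q∣≡∣p∪q∣ p q))) (+-monoˡ-≤ ∣ q ∣ (∣p─q∣≤∣p∣ p q))

q⊆p⇒∣p─q∣+∣q∣≤∣p∣ : ∀ (p q : Subset n) → q ⊆ p → ∣ p ─ q ∣ + ∣ q ∣ ≤ ∣ p ∣
q⊆p⇒∣p─q∣+∣q∣≤∣p∣ p q q⊆p = ≤-trans (≤-reflexive (∣p─q∣+∣q∣≡∣p∪q∣ p q))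
  (p⊆q⇒∣p∣≤∣q∣ λ x∈p∪q → [ (λ x∈p → x∈p) , q⊆p ]′ (x∈p∪q⁻ p q x∈p∪q))

q⊆r⇒p─r⊆p─q : ∀ (p q r : Subset n) → q ⊆ r → p ─ r ⊆ p ─ q
q⊆r⇒p─r⊆p─q p q r q⊆r x∈p─r =
  x∈p∧x∉q⇒x∈p─q (p─q⊆p p r x∈p─r) (x∈p─q⇒x∉q p r x∈p─r ∘ q⊆r)

nonempty⇒0<∣p∣ : {p : Subset n} → Nonempty p → 0 < ∣ p ∣
nonempty⇒0<∣p∣ {p = p} (x , x∈p) = ≤-trans (≤-reflexive (sym (∣⁅x⁆∣≡1 x)))
  (p⊆q⇒∣p∣≤∣q∣ λ y∈⁅x⁆ → subst (_∈ p) (sym (x∈⁅y⁆⇒x≡y x y∈⁅x⁆)) x∈p)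

∣p∣≤1⇒x≡y : {p : Subset n} → ∣ p ∣ ≤ 1 → ∀ {x y} → x ∈ p → y ∈ p → x ≡ y
∣p∣≤1⇒x≡y {p = p} ∣p∣≤1 {x} {y} x∈p y∈p with x ≟ᶠ y
... | yes x≡y = x≡y
... | no  x≢y = contradiction
  (≤-trans (s≤s (nonempty⇒0<∣p∣ (x , x∈p∧x≢y⇒x∈p-y x∈p x≢y))) (≤-trans (x∈p⇒∣p-x∣<∣p∣ y∈p) ∣p∣≤1))
  λ { (s≤s ()) }

subset-of-size : ∀ m (p : Subset n) → m ≤ ∣ p ∣ → ∃ λ q → q ⊆ p × ∣ q ∣ ≡ m
subset-of-size {n} zero p _ = ∅ , ⊆-min p , ∣⊥∣≡0 n
subset-of-size (suc m) (outside ∷ p) m≤∣p∣ =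
  let q , q⊆p , ∣q∣≡m = subset-of-size (suc m) p m≤∣p∣ in outside ∷ q , out⊆ q⊆p , ∣q∣≡m
subset-of-size (suc m) (inside ∷ p) (s≤s m≤∣p∣) =
  let q , q⊆p , ∣q∣≡m = subset-of-size m p m≤∣p∣ in inside ∷ q , in⊆in q⊆p , cong suc ∣q∣≡m

x∈⋃⁻ : ∀ (ps : List (Subset n)) {x} → x ∈ ⋃ ps → Any (x ∈_) ps
x∈⋃⁻ []       x∈∅ = contradiction x∈∅ ∉⊥
x∈⋃⁻ (p ∷ ps) x∈⋃ = [ here , there ∘ x∈⋃⁻ ps ]′ (x∈p∪q⁻ p (⋃ ps) x∈⋃)

x∈⋃⁺ : ∀ {ps : List (Subset n)} {x} → Any (x ∈_) ps → x ∈ ⋃ ps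
x∈⋃⁺ (here x∈p)    = x∈p∪q⁺ (inj₁ x∈p)
x∈⋃⁺ (there x∈ps)  = x∈p∪q⁺ (inj₂ (x∈⋃⁺ x∈ps))

∣⋃⁅zs⁆∣≤length : (zs : List (Fin n)) → ∣ ⋃ (map ⁅_⁆ zs) ∣ ≤ length zs
∣⋃⁅zs⁆∣≤length {n} [] = ≤-reflexive (∣⊥∣≡0 n)
∣⋃⁅zs⁆∣≤length (z ∷ zs) = ≤-trans (∣p∪q∣≤∣p∣+∣q∣ ⁅ z ⁆ _)
  (+-mono-≤ (≤-reflexive (∣⁅x⁆∣≡1 z)) (∣⋃⁅zs⁆∣≤length zs))

-- A single point of a union lies in one of the united sets. The list is kept nonempty so that an
-- empty `p` also has a member to lie in.
∣p∣≤1∧p⊆⋃⇒ : ∀ {p : Subset n} q ps → ∣ p ∣ ≤ 1 → p ⊆ ⋃ (q ∷ ps) → Any (p ⊆_) (q ∷ ps)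
∣p∣≤1∧p⊆⋃⇒ {p = p} q ps ∣p∣≤1 p⊆⋃ with nonempty? p
... | no ∄x = here λ x∈p → contradiction (_ , x∈p) ∄x
... | yes (x , x∈p) = Any.map
  (λ {r} x∈r {_} y∈p → subst (_∈ r) (∣p∣≤1⇒x≡y ∣p∣≤1 x∈p y∈p) x∈r) (x∈⋃⁻ (q ∷ ps) (p⊆⋃ x∈p))

-- Counting the subsets of `[t]` with at most `m` points, by splitting on the first point.

tails : Side → List (Subset (suc t)) → List (Subset t)
tails s []             = []
tails s ((s′ ∷ p) ∷ ps) with s ≟ᵇ s′
... | yes _ = p ∷ tails s ps
... | no  _ = tails s ps

length-tails : (ps : List (Subset (suc t))) →
  length (tails inside ps) + length (tails outside ps) ≡ length ps
length-tails []                   = refl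
length-tails ((inside  ∷ p) ∷ ps) = cong suc (length-tails ps)
length-tails ((outside ∷ p) ∷ ps) =
  trans (+-suc (length (tails inside ps)) _) (cong suc (length-tails ps))

All-tails : ∀ s {P : Subset (suc t) → Set} {ps} → All P ps → All (P ∘ (s ∷_)) (tails s ps)
All-tails s [] = []
All-tails s {ps = (s′ ∷ p) ∷ ps} (px ∷ pxs) with s ≟ᵇ s′
... | yes refl = px ∷ All-tails s pxs
... | no  _    = All-tails s pxs

Unique-tails : ∀ s {ps : List (Subset (suc t))} → Unique ps → Unique (tails s ps)
Unique-tails s [] = []
Unique-tails s {(s′ ∷ p) ∷ ps} (p∉ps ∷ ps!) with s ≟ᵇ s′
... | yes refl = All.map (_∘ cong (s ∷_)) (All-tails s p∉ps) ∷ Unique-tails s ps!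
... | no  _    = Unique-tails s ps!

-- If each point has weight 1 / L, the subsets of [t] have total weight (1 + 1 / L) ^ t, and those
-- with at most m points weigh at least 1 / L ^ m each.
length-small-subsets : ∀ L .{{_ : NonZero L}} m (ps : List (Subset t)) →
  Unique ps → All (λ p → ∣ p ∣ ≤ m) ps → length ps * L ^ t ≤ suc L ^ t * L ^ m
length-small-subsets {zero} L m [] _ _ = z≤n
length-small-subsets {zero} L m ([] ∷ []) _ _ = ≤-trans (m^n>0 L m) (m≤m+n (L ^ m) 0)
length-small-subsets {zero} L m ([] ∷ [] ∷ ps) ((p≢q ∷ _) ∷ _) _ = contradiction refl p≢q
length-small-subsets {suc t} L m ps ps! ps≤m = begin
  length ps * L ^ suc t                    ≡⟨ cong (_* L ^ suc t) (length-tails ps) ⟨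
  (length ins + length outs) * (L * L ^ t) ≡⟨ regroup (length ins) (length outs) L (L ^ t) ⟩
  length ins * L ^ t * L + L * (length outs * L ^ t)
    ≤⟨ +-mono-≤ (ins-bound m (Unique-tails inside ps!) (All-tails inside ps≤m)) (*-monoʳ-≤ L
        (length-small-subsets L m outs (Unique-tails outside ps!) (All-tails outside ps≤m))) ⟩
  suc L ^ t * L ^ m + L * (suc L ^ t * L ^ m) ≡⟨ *-assoc (suc L) (suc L ^ t) (L ^ m) ⟨
  suc L ^ suc t * L ^ m                    ∎
  where
  open ≤-Reasoning
  ins outs : List (Subset t)
  ins  = tails inside ps
  outs = tails outside ps
  regroup : ∀ i o l x → (i + o) * (l * x) ≡ i * x * l + l * (o * x)
  regroup = solve-∀
  rotate : ∀ x y z → x * y * z ≡ x * (z * y)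
  rotate = solve-∀
  -- A subset through the first point has room for only `m - 1` others, which is where the spare
  -- factor `L` comes from. With `m = 0` there is no such subset.
  ins-bound : ∀ m {qs : List (Subset t)} → Unique qs → All (λ p → suc ∣ p ∣ ≤ m) qs →
    length qs * L ^ t * L ≤ suc L ^ t * L ^ m
  ins-bound m       {[]}     _   _          = z≤n
  ins-bound zero    {q ∷ qs} _   (() ∷ _)
  ins-bound (suc m) {q ∷ qs} qs! qs<m = begin
    length (q ∷ qs) * L ^ t * L
      ≤⟨ *-monoˡ-≤ L (length-small-subsets L m (q ∷ qs) qs! (All.map s≤s⁻¹ qs<m)) ⟩
    suc L ^ t * L ^ m * L   ≡⟨ rotate (suc L ^ t) (L ^ m) L ⟩
    suc L ^ t * L ^ suc m   ∎

-- Bernoulli's inequality `(1 - 1 / (L + 1)) ^ j ≥ 1 - j / (L + 1)` with denominators cleared and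
-- `i` standing for `L - j`. At `i = 0` it says `(1 + 1 / L) ^ L ≤ L + 1`.
bernoulli : ∀ i j {L} → i + j ≡ L → suc i * suc L ^ j ≤ suc L * L ^ j
bernoulli i zero    {L} i+j≡L =
  *-monoˡ-≤ 1 (s≤s (≤-trans (m≤m+n i 0) (≤-reflexive i+j≡L)))
bernoulli i (suc j) {L} i+j≡L = begin
  suc i * (suc L * suc L ^ j)  ≡⟨ *-assoc (suc i) (suc L) _ ⟨
  suc i * suc L * suc L ^ j    ≤⟨ *-monoˡ-≤ (suc L ^ j) step ⟩
  L * suc (suc i) * suc L ^ j  ≡⟨ *-assoc L (suc (suc i)) _ ⟩
  L * (suc (suc i) * suc L ^ j) ≤⟨ *-monoʳ-≤ L (bernoulli (suc i) j (trans (sym (+-suc i j)) i+j≡L)) ⟩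
  L * (suc L * L ^ j)          ≡⟨ swap L (suc L) (L ^ j) ⟩
  suc L * (L * L ^ j)          ∎
  where
  open ≤-Reasoning
  swap : ∀ x y z → x * (y * z) ≡ y * (x * z)
  swap = solve-∀
  -- After expansion this is `i + 1 ≤ L`, which holds because `j` has not yet reached zero.
  step : suc i * suc L ≤ L * suc (suc i)
  step = begin
    suc i * suc L      ≡⟨ *-suc (suc i) L ⟩
    suc i + suc i * L  ≤⟨ +-monoˡ-≤ (suc i * L) (≤-trans (m≤m+n (suc i) j) (≤-reflexive (trans (sym (+-suc i j)) i+j≡L))) ⟩
    L + suc i * L      ≡⟨ *-comm (suc (suc i)) L ⟩
    L * suc (suc i)    ∎

^-distribʳ-* : ∀ x y m → (x * y) ^ m ≡ x ^ m * y ^ m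
^-distribʳ-* x y zero    = refl
^-distribʳ-* x y (suc m) =
  trans (cong (x * y *_) (^-distribʳ-* x y m)) (interchange x y (x ^ m) (y ^ m))
  where
  interchange : ∀ x y z w → x * y * (z * w) ≡ x * z * (y * w)
  interchange = solve-∀

-- The total weight `(1 + 1 / L) ^ t` only grows when `t` is padded by `e` up to `L * m`, and there
-- Bernoulli's inequality bounds it by `(L + 1) ^ m`.
length-small-subsets′ : ∀ L .{{_ : NonZero L}} m (ps : List (Subset t)) →
  Unique ps → All (λ p → ∣ p ∣ ≤ m) ps → t ≤ L * m → length ps ≤ (suc L * L) ^ m
length-small-subsets′ {t} L m ps ps! ps≤m t≤Lm =
  *-cancelʳ-≤ _ _ (L ^ (L * m)) {{m^n≢0 L (L * m)}} (begin
    length ps * L ^ (L * m)             ≡⟨ cong (λ x → length ps * L ^ x) t+e≡Lm ⟨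
    length ps * L ^ (t + e)             ≡⟨ cong (length ps *_) (^-distribˡ-+-* L t e) ⟩
    length ps * (L ^ t * L ^ e)         ≡⟨ *-assoc (length ps) (L ^ t) (L ^ e) ⟨
    length ps * L ^ t * L ^ e           ≤⟨ *-mono-≤ (length-small-subsets L m ps ps! ps≤m) (^-monoˡ-≤ e (n≤1+n L)) ⟩
    suc L ^ t * L ^ m * suc L ^ e       ≡⟨ rotate (suc L ^ t) (L ^ m) (suc L ^ e) ⟩
    suc L ^ t * suc L ^ e * L ^ m       ≡⟨ cong (_* L ^ m) (^-distribˡ-+-* (suc L) t e) ⟨
    suc L ^ (t + e) * L ^ m             ≡⟨ cong (λ x → suc L ^ x * L ^ m) t+e≡Lm ⟩
    suc L ^ (L * m) * L ^ m             ≡⟨ cong (_* L ^ m) (^-*-assoc (suc L) L m) ⟨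
    (suc L ^ L) ^ m * L ^ m             ≤⟨ *-monoˡ-≤ (L ^ m) (^-monoˡ-≤ m (≤-trans (m≤m+n _ 0) (bernoulli 0 L refl))) ⟩
    (suc L * L ^ L) ^ m * L ^ m         ≡⟨ cong (_* L ^ m) (^-distribʳ-* (suc L) (L ^ L) m) ⟩
    suc L ^ m * (L ^ L) ^ m * L ^ m     ≡⟨ rotate (suc L ^ m) ((L ^ L) ^ m) (L ^ m) ⟩
    suc L ^ m * L ^ m * (L ^ L) ^ m     ≡⟨ cong₂ _*_ (sym (^-distribʳ-* (suc L) L m)) (^-*-assoc L L m) ⟩
    (suc L * L) ^ m * L ^ (L * m)       ∎)
  where
  open ≤-Reasoning
  e : ℕ
  e = L * m ∸ t
  t+e≡Lm : t + e ≡ L * m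
  t+e≡Lm = m+[n∸m]≡n t≤Lm
  rotate : ∀ x y z → x * y * z ≡ x * z * y
  rotate = solve-∀

-- Cover-free families and own subsets.

module CoverFree {n t k : ℕ} (A : Fin n → Subset t)
  (cover-free : ∀ {z} zs → All (z ≢_) zs → length zs < k → Nonempty (A z ─ ⋃ (map A zs)))
  where

  ⋃A : List (Fin n) → Subset t
  ⋃A zs = ⋃ (map A zs)

  Own : ℕ → Fin n → Subset t → Set
  Own m z S = S ⊆ A z × ∣ S ∣ ≤ m × (∀ y → S ⊆ A y → y ≡ z)

  HasOwn : ℕ → Fin n → Set
  HasOwn m z = ∃ (Own m z)

  own? : ∀ m z S → Dec (Own m z S)
  own? m z S = (S ⊆? A z) ×-dec (∣ S ∣ ≤? m) ×-dec all? (λ y → (S ⊆? A y) →-dec (y ≟ᶠ z))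

  hasOwn? : ∀ m → Decidable (HasOwn m)
  hasOwn? m z = anySubset? (own? m z)

  -- There are finitely many indices, so the failure of `S` to be own is witnessed by a concrete
  -- `y`, found by search.
  other-superset : ∀ {m z S} → ¬ HasOwn m z → S ⊆ A z → ∣ S ∣ ≤ m → ∃ λ y → z ≢ y × S ⊆ A y
  other-superset {m} {z} {S} ¬own S⊆Az ∣S∣≤m
    with any? {P = λ y → z ≢ y × S ⊆ A y} (λ y → ¬? (z ≟ᶠ y) ×-dec (S ⊆? A y))
  ... | yes p  = p
  ... | no  ∄y = contradiction (S , (λ {_} → S⊆Az) , ∣S∣≤m , only-z) ¬own
    where
    only-z : ∀ y → S ⊆ A y → y ≡ z
    only-z y S⊆Ay = sym (decidable-stable (z ≟ᶠ y) λ z≢y → ∄y (y , z≢y , S⊆Ay))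

  -- Here `d` counts the sets that may still be adjoined to `zs` while cover-freeness applies. Each
  -- can be chosen to absorb `m` uncovered points, and a point must survive them all.
  uncovered-part : ∀ {m z} d zs → ¬ HasOwn m z → All (z ≢_) zs → d + length zs < k →
    d * m < ∣ A z ─ ⋃A zs ∣
  uncovered-part zero zs ¬own z∉zs zs<k = nonempty⇒0<∣p∣ (cover-free zs z∉zs zs<k)
  uncovered-part {m} {z} (suc d) zs ¬own z∉zs zs<k = large
    where
    open ≤-Reasoning
    D : Subset t
    D = A z ─ ⋃A zs
    -- Adding to zs some y with S ⊆ A y costs at least S, and the induction bounds what is left.
    remove : ∀ S → S ⊆ D → ∣ S ∣ ≤ m → d * m + ∣ S ∣ < ∣ D ∣
    remove S S⊆D ∣S∣≤m with other-superset ¬own (p─q⊆p (A z) _ ∘ S⊆D) ∣S∣≤m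
    ... | y , z≢y , S⊆Ay = begin-strict
      d * m + ∣ S ∣                <⟨ +-monoˡ-< ∣ S ∣ (uncovered-part d (y ∷ zs) ¬own (z≢y ∷ z∉zs)
                                       (≤-trans (s≤s (≤-reflexive (+-suc d (length zs)))) zs<k)) ⟩
      ∣ A z ─ (A y ∪ ⋃A zs) ∣ + ∣ S ∣ ≡⟨ cong (λ p → ∣ p ∣ + ∣ S ∣)
                                       (trans (sym (p─q─r≡p─q∪r (A z) (A y) (⋃A zs))) (p─q─r≡p─r─q (A z) (A y) (⋃A zs))) ⟩
      ∣ D ─ A y ∣ + ∣ S ∣          ≤⟨ +-monoˡ-≤ ∣ S ∣ (p⊆q⇒∣p∣≤∣q∣ (q⊆r⇒p─r⊆p─q D S (A y) S⊆Ay)) ⟩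
      ∣ D ─ S ∣ + ∣ S ∣            ≤⟨ q⊆p⇒∣p─q∣+∣q∣≤∣p∣ D S S⊆D ⟩
      ∣ D ∣                        ∎
    large : m + d * m < ∣ D ∣
    large with m ≤? ∣ D ∣
    -- If `D` had fewer than `m` points, it could itself serve as `S`, and `remove` would make `D`
    -- larger than itself.
    ... | no  m≰∣D∣ = contradiction
      (≤-trans (s≤s (m≤n+m ∣ D ∣ (d * m))) (remove D ⊆-refl (<⇒≤ (≰⇒> m≰∣D∣)))) (<-irrefl refl)
    ... | yes m≤∣D∣ with subset-of-size m D m≤∣D∣
    ...   | S , S⊆D , refl = subst (_< ∣ D ∣) (+-comm (d * m) m) (remove S S⊆D ≤-refl)

  ∣⋃A∷∣ : ∀ z zs → ∣ A z ─ ⋃A zs ∣ + ∣ ⋃A zs ∣ ≡ ∣ ⋃A (z ∷ zs) ∣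
  ∣⋃A∷∣ z zs = ∣p─q∣+∣q∣≡∣p∪q∣ (A z) (⋃A zs)

  -- This is ∣ ⋃A zs ∣ ≥ ∑ (m (d + i) + 1) over i < length zs, doubled and cleared of subtraction.
  ⋃A-large : ∀ {m} d zs → Unique zs → All (¬_ ∘ HasOwn m) zs → d + length zs ≤ k →
    2 * length zs + m * (2 * d * length zs + length zs * length zs)
      ≤ 2 * ∣ ⋃A zs ∣ + m * length zs
  ⋃A-large {m} d [] _ _ _ = ≤-trans (≤-reflexive (vanish m d)) z≤n
    where
    vanish : ∀ m d → m * (2 * d * 0 + 0) ≡ 0
    vanish = solve-∀
  ⋃A-large {m} d (z ∷ zs) (z∉zs ∷ zs!) (¬own ∷ ¬owns) d+l≤k = begin
    2 * suc l + m * (2 * d * suc l + suc l * suc l)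
      ≡⟨ expand l m d ⟩
    2 * l + m * (2 * suc d * l + l * l) + (2 * suc (d * m) + m)
      -- The sets of `zs` are united before `A z`, so they have `suc d` sets to spare where `z` has
      -- only `d`.
      ≤⟨ +-mono-≤ (⋃A-large (suc d) zs zs! ¬owns d+l<k)
           (+-monoˡ-≤ m (*-monoʳ-≤ 2 (uncovered-part d zs ¬own z∉zs d+l<k))) ⟩
    2 * ∣ ⋃A zs ∣ + m * l + (2 * ∣ A z ─ ⋃A zs ∣ + m)
      ≡⟨ collect (∣ ⋃A zs ∣) m l (∣ A z ─ ⋃A zs ∣) ⟩
    2 * (∣ A z ─ ⋃A zs ∣ + ∣ ⋃A zs ∣) + m * suc l
      ≡⟨ cong (λ x → 2 * x + m * suc l) (∣⋃A∷∣ z zs) ⟩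
    2 * ∣ ⋃A (z ∷ zs) ∣ + m * suc l ∎
    where
    open ≤-Reasoning
    l : ℕ
    l = length zs
    d+l<k : suc d + l ≤ k
    d+l<k = ≤-trans (≤-reflexive (sym (+-suc d l))) d+l≤k
    expand : ∀ l m d → 2 * suc l + m * (2 * d * suc l + suc l * suc l)
      ≡ 2 * l + m * (2 * suc d * l + l * l) + (2 * suc (d * m) + m)
    expand = solve-∀
    collect : ∀ u m l v → 2 * u + m * l + (2 * v + m) ≡ 2 * (v + u) + m * suc l
    collect = solve-∀

  -- Exactly `k` of the indices are kept, the most that `⋃A-large` admits at `d = 0`, and their
  -- union has at most `t` points.
  k-without-own : ∀ {m} zs → Unique zs → All (¬_ ∘ HasOwn m) zs → k ≤ length zs →
    2 * k + m * (k * k) ≤ 2 * t + m * k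
  k-without-own {m} zs zs! ¬owns k≤l = begin
    2 * k + m * (k * k)                          ≡⟨ cong (λ l → 2 * l + m * (l * l)) length-ys ⟨
    2 * length ys + m * (length ys * length ys)  ≤⟨ ⋃A-large 0 ys (take⁺ k zs!) (All-take⁺ k ¬owns) (≤-reflexive length-ys) ⟩
    2 * ∣ ⋃A ys ∣ + m * length ys                ≤⟨ +-monoˡ-≤ (m * length ys) (*-monoʳ-≤ 2 (∣p∣≤n (⋃A ys))) ⟩
    2 * t + m * length ys                        ≡⟨ cong (λ l → 2 * t + m * l) length-ys ⟩
    2 * t + m * k                                ∎
    where
    open ≤-Reasoning
    ys : List (Fin n)
    ys = take k zs
    length-ys : length ys ≡ k
    length-ys = trans (length-take k zs) (m≤n⇒m⊓n≡m k≤l)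

  -- Counting the indices with and without an own subset.

  owned unowned : ℕ → List (Fin n)
  owned   m = filter (hasOwn? m) (allFin n)
  unowned m = filter (¬? ∘ hasOwn? m) (allFin n)

  owned-own : ∀ m → All (HasOwn m) (owned m)
  owned-own m = all-filter (hasOwn? m) (allFin n)

  unowned-¬own : ∀ m → All (¬_ ∘ HasOwn m) (unowned m)
  unowned-¬own m = all-filter (¬? ∘ hasOwn? m) (allFin n)

  owned-unique : ∀ m → Unique (owned m)
  owned-unique m = filter⁺ (hasOwn? m) (allFin⁺ n)

  unowned-unique : ∀ m → Unique (unowned m)
  unowned-unique m = filter⁺ (¬? ∘ hasOwn? m) (allFin⁺ n)

  length-owned-++-unowned : ∀ m → length (owned m ++ unowned m) ≡ n
  length-owned-++-unowned m = begin
    length (owned m ++ unowned m)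
      ≡⟨ cong (λ (ys , zs) → length (ys ++ zs)) (partition-defn (hasOwn? m) (allFin n)) ⟨
    length (proj₁ parts ++ proj₂ parts)
      ≡⟨ ↭.xs↭ys⇒|xs|≡|ys| (↭.partition-↭ (hasOwn? m) (allFin n)) ⟨
    length (allFin n)
      ≡⟨ length-tabulate (λ i → i) ⟩
    n ∎
    where
    open ≡-Reasoning
    module ↭ = PermutationProperties (setoid (Fin n))
    parts : List (Fin n) × List (Fin n)
    parts = partition (hasOwn? m) (allFin n)

  own-injective : ∀ {m y z S} → Own m y S → Own m z S → y ≡ z
  own-injective (S⊆Ay , _) (_ , _ , only-z) = only-z _ S⊆Ay

  owns : ∀ {m zs} → All (HasOwn m) zs → List (Subset t)
  owns = All.reduce proj₁

  length-owns : ∀ {m zs} (pzs : All (HasOwn m) zs) → length (owns pzs) ≡ length zs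
  length-owns []        = refl
  length-owns (_ ∷ pzs) = cong suc (length-owns pzs)

  owns-small : ∀ {m zs} (pzs : All (HasOwn m) zs) → All (λ S → ∣ S ∣ ≤ m) (owns pzs)
  owns-small []                            = []
  owns-small ((_ , _ , ∣S∣≤m , _) ∷ pzs) = ∣S∣≤m ∷ owns-small pzs

  owns-unique : ∀ {m zs} (pzs : All (HasOwn m) zs) → Unique zs → Unique (owns pzs)
  owns-unique []                _            = []
  owns-unique {m} ((S , own) ∷ pzs) (z∉zs ∷ zs!) = fresh pzs z∉zs ∷ owns-unique pzs zs!
    where
    fresh : ∀ {zs} (pzs : All (HasOwn m) zs) → All (_ ≢_) zs → All (S ≢_) (owns pzs)
    fresh []                _            = []
    fresh ((_ , own′) ∷ pzs) (z≢y ∷ z∉zs) = (λ { refl → z≢y (own-injective own own′) }) ∷ fresh pzs z∉zs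

  -- An own subset determines its index, so choosing one for each index is injective and the count
  -- of small subsets applies.
  length-owned : ∀ L .{{_ : NonZero L}} m → t ≤ L * m → length (owned m) ≤ (suc L * L) ^ m
  length-owned L m t≤Lm = subst (_≤ (suc L * L) ^ m) (length-owns pzs)
    (length-small-subsets′ L m (owns pzs) (owns-unique pzs (owned-unique m))
      (owns-small pzs) t≤Lm)
    where
    pzs : All (HasOwn m) (owned m)
    pzs = owned-own m

  few-or-large : ∀ L .{{_ : NonZero L}} m → t ≤ L * m →
    n ≤ (suc L * L) ^ m + k ⊎ 2 * k + m * (k * k) ≤ 2 * t + m * k
  few-or-large L m t≤Lm with k ≤? length (unowned m)
  ... | yes k≤l = inj₂ (k-without-own (unowned m) (unowned-unique m) (unowned-¬own m) k≤l)
  ... | no k≰l = inj₁ (begin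
    n                                        ≡⟨ length-owned-++-unowned m ⟨
    length (owned m ++ unowned m)            ≡⟨ length-++ (owned m) ⟩
    length (owned m) + length (unowned m)    ≤⟨ +-mono-≤ (length-owned L m t≤Lm) (<⇒≤ (≰⇒> k≰l)) ⟩
    (suc L * L) ^ m + k                      ∎)
    where open ≤-Reasoning

  -- An own subset with at most one point cannot be shared among several covering sets: a cover of
  -- `A z` by other sets, however many, would put it inside one of them.
  owned-uncovered : ∀ {z} → 0 < k → HasOwn 1 z → ∀ zs → All (z ≢_) zs → Nonempty (A z ─ ⋃A zs)
  -- `S` may be empty, so with nothing to cover `A z` its nonemptiness comes from cover-freeness,
  -- which requires `0 < k`.
  owned-uncovered 0<k _ [] _ = cover-free [] [] 0<k
  owned-uncovered {z} 0<k (S , S⊆Az , ∣S∣≤1 , only-z) (y ∷ ys) z∉zs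
    with nonempty? (A z ─ ⋃A (y ∷ ys))
  ... | yes nonempty = nonempty
  ... | no  empty    =
    let z≢y , S⊆Ay = All.lookupAny z∉zs (map⁻ (∣p∣≤1∧p⊆⋃⇒ (A y) (map A ys) ∣S∣≤1 (λ x∈S → Az⊆⋃A (S⊆Az x∈S))))
    in contradiction (sym (only-z _ S⊆Ay)) z≢y
    where
    Az⊆⋃A : A z ⊆ ⋃A (y ∷ ys)
    Az⊆⋃A {x} x∈Az = decidable-stable (x ∈? ⋃A (y ∷ ys)) λ x∉⋃A → empty (x , x∈p∧x∉q⇒x∈p─q x∈Az x∉⋃A)

  ⋃A-grows : ∀ z zs → Nonempty (A z ─ ⋃A zs) → length zs ≤ ∣ ⋃A zs ∣ →
    length (z ∷ zs) ≤ ∣ ⋃A (z ∷ zs) ∣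
  ⋃A-grows z zs nonempty l≤⋃ =
    ≤-trans (+-mono-≤ (nonempty⇒0<∣p∣ nonempty) l≤⋃) (≤-reflexive (∣⋃A∷∣ z zs))

  -- The union is built from the end of the list. Each set of `qs` meets fewer than `k`
  -- predecessors, so cover-freeness gives it a new point; the sets of `ps` gain one over any number
  -- of predecessors.
  length≤∣⋃A∣ : ∀ ps qs → 0 < k → All (HasOwn 1) ps → Unique (ps ++ qs) → length qs ≤ k →
    length (ps ++ qs) ≤ ∣ ⋃A (ps ++ qs) ∣
  length≤∣⋃A∣ [] [] _ _ _ _ = z≤n
  length≤∣⋃A∣ [] (q ∷ qs) 0<k _ (q∉qs ∷ qs!) q∷qs≤k =
    ⋃A-grows q qs (cover-free qs q∉qs q∷qs≤k) (length≤∣⋃A∣ [] qs 0<k [] qs! (<⇒≤ q∷qs≤k))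
  length≤∣⋃A∣ (p ∷ ps) qs 0<k (own ∷ owns) (p∉ ∷ ps++qs!) qs≤k =
    ⋃A-grows p (ps ++ qs) (owned-uncovered 0<k own (ps ++ qs) p∉)
      (length≤∣⋃A∣ ps qs 0<k owns ps++qs! qs≤k)

  n≤t-or-large : 0 < k → n ≤ t ⊎ 2 * k + 1 * (k * k) ≤ 2 * t + 1 * k
  n≤t-or-large 0<k with k ≤? length (unowned 1)
  ... | yes k≤l = inj₂ (k-without-own (unowned 1) (unowned-unique 1) (unowned-¬own 1) k≤l)
  ... | no k≰l = inj₁ (begin
    n                              ≡⟨ length-owned-++-unowned 1 ⟨
    length (owned 1 ++ unowned 1)  ≤⟨ length≤∣⋃A∣ (owned 1) (unowned 1) 0<k (owned-own 1)
                                        unique (<⇒≤ (≰⇒> k≰l)) ⟩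
    ∣ ⋃A (owned 1 ++ unowned 1) ∣  ≤⟨ ∣p∣≤n (⋃A (owned 1 ++ unowned 1)) ⟩
    t                              ∎)
    where
    open ≤-Reasoning
    unique : Unique (owned 1 ++ unowned 1)
    unique = ++⁺ (owned-unique 1) (unowned-unique 1)
      λ (z∈owned , z∈unowned) →
        All.lookup (unowned-¬own 1) z∈unowned
          (All.lookup (owned-own 1) z∈owned)

-- Dualization: transposing the incidence matrix of the family.

module Dual {n k : ℕ} (𝓕 : Family n) (selective : StronglySelective n k 𝓕) where

  A : Fin n → Subset (size 𝓕)
  A z = tabulate λ i → Vec.lookup (lookup (members 𝓕) i) z

  ∈A⁺ : ∀ {z i} → z ∈ lookup (members 𝓕) i → i ∈ A z
  ∈A⁺ {z} {i} z∈F = lookup⇒[]= i (A z) (trans (lookup∘tabulate _ i) ([]=⇒lookup z∈F))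

  ∈A⁻ : ∀ {z i} → i ∈ A z → z ∈ lookup (members 𝓕) i
  ∈A⁻ {z} {i} i∈Az = lookup⇒[]= z _ (trans (sym (lookup∘tabulate _ i)) ([]=⇒lookup i∈Az))

  -- Apply selectivity to the set `Z` formed by `z` and `zs`. The member meeting `Z` only in `z` is,
  -- as an index, a point of `A z` outside `A y` for every `y` in `zs`.
  cover-free : ∀ {z} zs → All (z ≢_) zs → length zs < k → Nonempty (A z ─ ⋃ (map A zs))
  cover-free {z} zs z∉zs zs<k
    with selective (⋃ (map ⁅_⁆ (z ∷ zs))) (≤-trans (∣⋃⁅zs⁆∣≤length (z ∷ zs)) zs<k) z
           (x∈⋃⁺ {ps = map ⁅_⁆ (z ∷ zs)} (here (x∈⁅x⁆ z)))
  ... | F , F∈𝓕 , Z∩F≡⁅z⁆ = i , x∈p∧x∉q⇒x∈p─q (∈A⁺ (subst (z ∈_) F≡ z∈F)) i∉⋃A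
    where
    Z : Subset n
    Z = ⋃ (map ⁅_⁆ (z ∷ zs))
    i : Fin (size 𝓕)
    i = Any.index F∈𝓕
    F≡ : F ≡ lookup (members 𝓕) i
    F≡ = lookup-index F∈𝓕
    z∈F : z ∈ F
    z∈F = proj₂ (x∈p∩q⁻ Z F (subst (z ∈_) (sym Z∩F≡⁅z⁆) (x∈⁅x⁆ z)))
    i∉⋃A : i ∉ ⋃ (map A zs)
    i∉⋃A i∈⋃A =
      let y , y∈zs , i∈Ay = find (map⁻ (x∈⋃⁻ (map A zs) i∈⋃A))
          y∈F = subst (y ∈_) (sym F≡) (∈A⁻ i∈Ay)
          y∈Z = x∈⋃⁺ {ps = map ⁅_⁆ (z ∷ zs)} (there (map⁺ (Any.map (λ { refl → x∈⁅x⁆ y }) y∈zs)))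
      in All.lookup z∉zs y∈zs (sym (x∈⁅y⁆⇒x≡y z (subst (y ∈_) Z∩F≡⁅z⁆ (x∈p∩q⁺ (y∈Z , y∈F)))))

  open CoverFree {k = k} A cover-free public

-- Arithmetic of the final bounds.

m<[1+m/n]*n : ∀ m n .{{_ : NonZero n}} → m < suc (m / n) * n
m<[1+m/n]*n m n = begin-strict
  m                  ≡⟨ m≡m%n+[m/n]*n m n ⟩
  m % n + m / n * n  <⟨ +-monoˡ-< (m / n * n) (m%n<n m n) ⟩
  suc (m / n) * n    ∎
  where open ≤-Reasoning

k^2≡k*k : ∀ k → k ^ 2 ≡ k * k
k^2≡k*k k = cong (k *_) (*-identityʳ k)

k+k*k≤2t : ∀ k t → 2 * k + 1 * (k * k) ≤ 2 * t + 1 * k → k + k * k ≤ 2 * t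
k+k*k≤2t k t large = +-cancelʳ-≤ k _ _ (begin
  k + k * k + k        ≡⟨ shuffle k ⟩
  2 * k + 1 * (k * k)  ≤⟨ large ⟩
  2 * t + 1 * k        ≡⟨ cong (2 * t +_) (*-identityˡ k) ⟩
  2 * t + k            ∎)
  where
  open ≤-Reasoning
  shuffle : ∀ k → k + k * k + k ≡ 2 * k + 1 * (k * k)
  shuffle = solve-∀

-- When `n ≤ t`, the upper bound on `k` passes from `2 * n` to `2 * t`; otherwise the own-subset
-- count at `m = 1` gives the claim directly.
k*k≤2t : ∀ {n k t} → (k + 1) ^ 2 ≤ 2 * n → n ≤ t ⊎ 2 * k + 1 * (k * k) ≤ 2 * t + 1 * k → k * k ≤ 2 * t
k*k≤2t {n} {k} {t} [k+1]²≤2n (inj₁ n≤t) = begin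
  k * k        ≤⟨ *-mono-≤ (m≤m+n k 1) (m≤m+n k 1) ⟩
  (k + 1) * (k + 1) ≡⟨ k^2≡k*k (k + 1) ⟨
  (k + 1) ^ 2  ≤⟨ [k+1]²≤2n ⟩
  2 * n        ≤⟨ *-monoʳ-≤ 2 n≤t ⟩
  2 * t        ∎
  where open ≤-Reasoning
k*k≤2t {n} {k} {t} _ (inj₂ large) = ≤-trans (m≤n+m (k * k) k) (k+k*k≤2t k t large)

-- Triple the inequality: on the right `6 t` is less than two copies of `m k²`, and `3 m k` is at
-- most one copy since `3 ≤ k`.
not-large : ∀ {k t m} → 3 ≤ k → 3 * t < m * (k * k) → ¬ (2 * k + m * (k * k) ≤ 2 * t + m * k)
not-large {k} {t} {m} 3≤k 3t<mkk large = <-irrefl refl (begin-strict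
  3 * (m * (k * k))                  ≤⟨ *-monoʳ-≤ 3 (≤-trans (m≤n+m _ (2 * k)) large) ⟩
  3 * (2 * t + m * k)                ≡⟨ shuffle t m k ⟩
  2 * (3 * t) + m * (3 * k)          <⟨ +-mono-<-≤ (*-monoʳ-< 2 3t<mkk) (*-monoʳ-≤ m (*-monoˡ-≤ k 3≤k)) ⟩
  2 * (m * (k * k)) + m * (k * k)    ≡⟨ +-comm (2 * (m * (k * k))) _ ⟩
  3 * (m * (k * k))                  ∎)
  where
  open ≤-Reasoning
  shuffle : ∀ t m k → 3 * (2 * t + m * k) ≡ 2 * (3 * t) + m * (3 * k)
  shuffle = solve-∀

-- From `k² + 1 ≤ k³` the power is at most `k ^ (5 m)`, and so is the summand `k`. Doubling costs
-- one more factor `k`, absorbed by `m ≥ 1`.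
few⇒n≤k^6m : ∀ {n k} m → 2 ≤ k → 1 ≤ m → n ≤ (suc (k * k) * (k * k)) ^ m + k → n ≤ k ^ (6 * m)
few⇒n≤k^6m {n} {k} m 2≤k 1≤m few = begin
  n                                  ≤⟨ few ⟩
  (suc (k * k) * (k * k)) ^ m + k    ≤⟨ +-mono-≤ (^-monoˡ-≤ m (*-monoˡ-≤ (k * k) 1+k²≤k³)) k≤k^5m ⟩
  (k * (k * k) * (k * k)) ^ m + k ^ (5 * m) ≡⟨ cong (λ x → x ^ m + k ^ (5 * m)) (fifth k) ⟩
  (k ^ 5) ^ m + k ^ (5 * m)          ≡⟨ cong (_+ k ^ (5 * m)) (^-*-assoc k 5 m) ⟩
  k ^ (5 * m) + k ^ (5 * m)          ≡⟨ cong (k ^ (5 * m) +_) (+-identityʳ _) ⟨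
  2 * k ^ (5 * m)                    ≤⟨ *-monoˡ-≤ (k ^ (5 * m)) 2≤k ⟩
  k ^ (1 + 5 * m)                    ≤⟨ ^-monoʳ-≤ k (+-monoˡ-≤ (5 * m) 1≤m) ⟩
  k ^ (6 * m)                        ∎
  where
  open ≤-Reasoning
  instance
    k≢0 : NonZero k
    k≢0 = >-nonZero (≤-trans (s≤s z≤n) 2≤k)
  fifth : ∀ k → k * (k * k) * (k * k) ≡ k * (k * (k * (k * (k * 1))))
  fifth = solve-∀
  1+k²≤k³ : suc (k * k) ≤ k * (k * k)
  1+k²≤k³ = begin
    1 + k * k      ≤⟨ +-monoˡ-≤ (k * k) (*-mono-≤ (>-nonZero⁻¹ k) (>-nonZero⁻¹ k)) ⟩
    k * k + k * k  ≡⟨ cong (k * k +_) (+-identityʳ (k * k)) ⟨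
    2 * (k * k)    ≤⟨ *-monoˡ-≤ (k * k) 2≤k ⟩
    k * (k * k)    ∎
  k≤k^5m : k ≤ k ^ (5 * m)
  k≤k^5m = ≤-trans (≤-reflexive (sym (^-identityʳ k))) (^-monoʳ-≤ k (*-mono-≤ {1} {5} (s≤s z≤n) 1≤m))

theorem3p4 : (n k : ℕ) → 1 ≤ k → k ≤ n →
    (𝓕 : Family n) → StronglySelective n k 𝓕 →
    (3 ≤ k → (k + 1) ≤√ (2 * n) →
    (k ^ 2) ·log₂ n ≤ (48 * size 𝓕) ·log₂ k)
    × (k ≥√ (2 * n) → n ≤ size 𝓕)
theorem3p4 n k 1≤k k≤n 𝓕 selective = logarithmic , linear
  where
  open Dual 𝓕 selective
  open ≤-Reasoning
  s : ℕ
  s = size 𝓕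

  instance
    k≢0 : NonZero k
    k≢0 = >-nonZero 1≤k
    kk≢0 : NonZero (k * k)
    kk≢0 = m*n≢0 k k

  logarithmic : 3 ≤ k → (k + 1) ≤√ (2 * n) → (k ^ 2) ·log₂ n ≤ (48 * size 𝓕) ·log₂ k
  logarithmic 3≤k [k+1]²≤2n = begin
    n ^ (k ^ 2)              ≡⟨ cong (n ^_) (k^2≡k*k k) ⟩
    n ^ (k * k)              ≤⟨ ^-monoˡ-≤ (k * k) n≤k^6m ⟩
    (k ^ (6 * m)) ^ (k * k)  ≡⟨ ^-*-assoc k (6 * m) (k * k) ⟩
    k ^ (6 * m * (k * k))    ≤⟨ ^-monoʳ-≤ k exponent ⟩
    k ^ (48 * s)             ∎
    where
    m : ℕ
    -- The least `m` with `3 s < m k²`: large enough to refute the second alternative, and small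
    -- enough that `m k² ≤ 3 s + k²`.
    m = suc ((3 * s) / (k * k))
    3s<mkk : 3 * s < m * (k * k)
    3s<mkk = m<[1+m/n]*n (3 * s) (k * k)
    s≤kkm : s ≤ k * k * m
    s≤kkm = begin
      s            ≤⟨ m≤n*m s 3 ⟩
      3 * s        <⟨ 3s<mkk ⟩
      m * (k * k)  ≡⟨ *-comm m (k * k) ⟩
      k * k * m    ∎
    n≤k^6m : n ≤ k ^ (6 * m)
    n≤k^6m with few-or-large (k * k) m s≤kkm
    ... | inj₁ few   = few⇒n≤k^6m m (<⇒≤ 3≤k) (s≤s z≤n) few
    ... | inj₂ large = contradiction large (not-large {t = s} {m} 3≤k 3s<mkk)
    sum : ∀ s → 6 * (2 * s + 3 * s) ≡ 30 * s
    sum = solve-∀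
    exponent : 6 * m * (k * k) ≤ 48 * s
    exponent = begin
      6 * m * (k * k)                            ≡⟨ *-assoc 6 m (k * k) ⟩
      6 * (k * k + (3 * s) / (k * k) * (k * k))
        ≤⟨ *-monoʳ-≤ 6 (+-mono-≤ (k*k≤2t {t = s} [k+1]²≤2n (n≤t-or-large 1≤k)) (m/n*n≤m (3 * s) (k * k))) ⟩
      6 * (2 * s + 3 * s)                        ≡⟨ sum s ⟩
      -- The estimate `m k² ≤ 5 s` yields the constant 30, within the required 48.
      30 * s                                     ≤⟨ *-monoˡ-≤ s (m≤m+n 30 18) ⟩
      48 * s                                     ∎

  linear : k ≥√ (2 * n) → n ≤ size 𝓕
  linear 2n≤k² with n≤t-or-large 1≤k
  ... | inj₁ n≤s   = n≤s
  ... | inj₂ large = *-cancelˡ-≤ 2 (begin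
    2 * n      ≤⟨ 2n≤k² ⟩
    k ^ 2      ≡⟨ k^2≡k*k k ⟩
    k * k      ≤⟨ m≤n+m (k * k) k ⟩
    k + k * k  ≤⟨ k+k*k≤2t k s large ⟩
    2 * s      ∎)
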